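{- Let $G$ and $H$ be finite simple graphs with nonempty vertex sets. If $G$ and $H$ are homomorphically equivalent, then $\alpha^o(G)=\alpha^o(H)$.
   Context: All graphs are simple, with finite and nonempty vertex set; $V(G)$ and $E(G)$ denote the vertex set and edge set of $G$. Circular altitude: a linear ordering of $V(G)$ is a bijection $\mathcal{U}:\{1,2,\ldots,|V(G)|\}\to V(G)$; write $u_i=\mathcal{U}(i)$. A $\mathcal{U}$-monotonic cycle of length $m$ ($m\ge 1$) is a sequence $u_{i_1},u_{i_2},\ldots,u_{i_m}$ of $m$ pairwise distinct vertices of $G$ such that, whenever $m>1$: (i) $i_1<i_2<\cdots<i_m$; (ii) $u_{i_t}$ and $u_{i_{t+1}}$ are adjacent for each $1\le t\le m-1$; (iii) $u_{i_m}$ and $u_{i_1}$ are adjacent. (So a single vertex is a monotonic cycle of length $1$, and an edge gives one of length $2$.) Let $|\mathcal{U}|$ denote the maximum length of a $\mathcal{U}$-monotonic cycle. The circular altitude $\alpha^o(G)$ is the minimum of $|\mathcal{U}|$ over all linear orderings $\mathcal{U}$ of $V(G)$. Homomorphisms: a homomorphism from $G$ to $H$ is a function $f:V(G)\to V(H)$ such that $xy\in E(G)$ implies $f(x)f(y)\in E(H)$ for all $x,y\in V(G)$. $G$ and $H$ are homomorphically equivalent if there exist a homomorphism from $G$ to $H$ and a homomorphism from $H$ to $G$. -}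

module Defs where

open import Data.Empty using (⊥)
open import Data.Fin.Base using (Fin; zero; suc; inject₁; fromℕ; finToFun; funToFin) renaming (_<_ to _<ᶠ_)
open import Data.Fin.Properties using (all?; any?; injective⇒≤; finToFun-funToFin) renaming (_≟_ to _≟ᶠ_; _<?_ to _<ᶠ?_)
open import Data.Nat.Base using (ℕ; zero; suc; NonZero; _≤_; _<_; _^_; z≤n; s≤s; s≤s⁻¹)
open import Data.Nat.Induction using (<-rec)
open import Data.Nat.Properties using (≤-antisym; ≤-refl; ≮⇒≥; ≤∧≢⇒<; anyUpTo?) renaming (_≟_ to _≟ℕ_; _<?_ to _<ℕ?_)
open import Data.Product.Base using (Σ; Σ-syntax; ∃; _×_; _,_; proj₁; proj₂)
open import Function.Base using (_∘_)
open import Function.Bundles using (_↔_; Inverse; mk↔ₛ′)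
open import Function.Construct.Composition using (_↔-∘_)
open import Function.Construct.Symmetry using (↔-sym)
open import Function.Definitions using (Injective)
open import Function.Properties.Inverse using (↔⇒↣)
open import Relation.Binary.Core using (Rel)
open import Relation.Binary.Definitions using (Symmetric; Irreflexive; DecidableEquality) renaming (Decidable to Decidable₂)
open import Relation.Binary.PropositionalEquality using (_≡_; _≗_; refl; sym; trans; cong; subst; subst₂)
open import Relation.Nullary using (Dec; yes; no; contradiction)
open import Relation.Nullary.Decidable using (map′; _×-dec_; _→-dec_; via-injection)
open import Relation.Unary using (Pred; Decidable)
open import Level using (0ℓ)

IsMinimum : Pred ℕ 0ℓ → ℕ → Set
IsMinimum P m = P m × (∀ k → P k → m ≤ k)

IsMaximum : Pred ℕ 0ℓ → ℕ → Set
IsMaximum P m = P m × (∀ k → P k → k ≤ m)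

module _ {P : Pred ℕ 0ℓ} (P? : Decidable P) where

  minimum : ∃ P → ∃ (IsMinimum P)
  minimum (k , Pk) = <-rec (λ k → P k → ∃ (IsMinimum P)) step k Pk
    where
    step : ∀ k → (∀ {j} → j < k → P j → ∃ (IsMinimum P)) → P k → ∃ (IsMinimum P)
    step k rec Pk with anyUpTo? P? k
    ... | yes (j , j<k , Pj) = rec j<k Pj
    ... | no ∄j              = k , Pk , λ j Pj → ≮⇒≥ (λ j<k → ∄j (j , j<k , Pj))

  maximum : ∀ b → (∀ k → P k → k ≤ b) → ∃ P → ∃ (IsMaximum P)
  maximum b bound ∃P with P? b
  ... | yes Pb = b , Pb , bound
  maximum zero bound (k , Pk) | no ¬P0 =
    contradiction (subst P (≤-antisym (bound k Pk) z≤n) Pk) ¬P0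
  maximum (suc b) bound ∃P | no ¬Pb =
    maximum b (λ k Pk → s≤s⁻¹ (≤∧≢⇒< (bound k Pk) (λ eq → ¬Pb (subst P eq Pk)))) ∃P

-- Finiteness is a bijection with `Fin order`; classically the decidability
-- of adjacency is no restriction.
record Graph : Set₁ where
  field
    Vertex      : Set
    order       : ℕ
    enumeration : Fin order ↔ Vertex
    nonempty    : NonZero order
    Adjacent    : Rel Vertex 0ℓ
    adjacent?   : Decidable₂ Adjacent
    symmetric   : Symmetric Adjacent
    irreflexive : Irreflexive _≡_ Adjacent

  _≟ⱽ_ : DecidableEquality Vertex
  _≟ⱽ_ = via-injection (↔⇒↣ (↔-sym enumeration)) _≟ᶠ_

open Graph

record Homomorphism (G H : Graph) : Set where
  field
    map      : Vertex G → Vertex H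
    preserve : ∀ x y → Adjacent G x y → Adjacent H (map x) (map y)

HomomorphicallyEquivalent : Graph → Graph → Set
HomomorphicallyEquivalent G H = Homomorphism G H × Homomorphism H G

-- Positions are numbered from 0.
LinearOrdering : Graph → Set
LinearOrdering G = Fin (order G) ↔ Vertex G

module _ (G : Graph) where

  -- The cycle of length m = suc k visiting the positions i zero, …, i (fromℕ k).
  -- When m = 1 the fields `increasing` and `consecutive` are vacuous.
  record IsMonotonicCycle (U : LinearOrdering G) {k} (i : Fin (suc k) → Fin (order G)) : Set where
    open Inverse U using () renaming (to to u)
    field
      distinct    : Injective _≡_ _≡_ (u ∘ i)
      increasing  : ∀ (t : Fin k) → i (inject₁ t) <ᶠ i (suc t)
      consecutive : ∀ (t : Fin k) → Adjacent G (u (i (inject₁ t))) (u (i (suc t)))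
      closing     : 1 < suc k → Adjacent G (u (i (fromℕ k))) (u (i zero))

  HasMonotonicCycle : LinearOrdering G → ℕ → Set
  HasMonotonicCycle U zero    = ⊥
  HasMonotonicCycle U (suc k) = ∃ (IsMonotonicCycle U {k})

  module _ (U : LinearOrdering G) where
    open Inverse U using () renaming (to to u)

    isMonotonicCycle? : ∀ {k} (i : Fin (suc k) → Fin (order G)) → Dec (IsMonotonicCycle U i)
    isMonotonicCycle? {k} i = map′
      (λ (d , inc , c , cl) → record
        { distinct = λ {s} {t} → d s t ; increasing = inc ; consecutive = c ; closing = cl })
      (λ C → let open IsMonotonicCycle C in
        (λ s t → distinct {s} {t}) , increasing , consecutive , closing)
      (all? (λ s → all? λ t → _≟ⱽ_ G (u (i s)) (u (i t)) →-dec s ≟ᶠ t)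
       ×-dec all? (λ t → i (inject₁ t) <ᶠ? i (suc t))
       ×-dec all? (λ t → adjacent? G (u (i (inject₁ t))) (u (i (suc t))))
       ×-dec (1 <ℕ? suc k →-dec adjacent? G (u (i (fromℕ k))) (u (i zero))))

  -- Being a monotonic cycle depends only on the values of U and i.
  isMonotonicCycle-resp : ∀ (U U′ : LinearOrdering G) → Inverse.to U ≗ Inverse.to U′ →
                          ∀ {k} {i i′ : Fin (suc k) → Fin (order G)} → i ≗ i′ →
                          IsMonotonicCycle U i → IsMonotonicCycle U′ i′
  isMonotonicCycle-resp U U′ U≗U′ {k} {i} {i′} i≗i′ C = record
    { distinct    = λ {s} {t} eq → distinct (trans (ui≗ s) (trans eq (sym (ui≗ t))))
    ; increasing  = λ t → subst₂ _<ᶠ_ (i≗i′ _) (i≗i′ _) (increasing t)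
    ; consecutive = λ t → subst₂ (Adjacent G) (ui≗ _) (ui≗ _) (consecutive t)
    ; closing     = λ 1<m → subst₂ (Adjacent G) (ui≗ _) (ui≗ _) (closing 1<m)
    }
    where
    open IsMonotonicCycle C
    ui≗ : ∀ t → Inverse.to U (i t) ≡ Inverse.to U′ (i′ t)
    ui≗ t = trans (U≗U′ (i t)) (cong (Inverse.to U′) (i≗i′ t))

  hasMonotonicCycle-resp : ∀ (U U′ : LinearOrdering G) → Inverse.to U ≗ Inverse.to U′ →
                           ∀ m → HasMonotonicCycle U m → HasMonotonicCycle U′ m
  hasMonotonicCycle-resp U U′ U≗U′ (suc k) (i , C) =
    i , isMonotonicCycle-resp U U′ U≗U′ (λ _ → refl) C

  hasMonotonicCycle? : ∀ U → Decidable (HasMonotonicCycle U)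
  hasMonotonicCycle? U zero    = no λ ()
  hasMonotonicCycle? U (suc k) = map′
    (λ (c , C) → finToFun c , C)
    (λ (i , C) → funToFin i ,
      isMonotonicCycle-resp U U (λ _ → refl) (λ t → sym (finToFun-funToFin i t)) C)
    (any? (λ (c : Fin (order G ^ suc k)) → isMonotonicCycle? U (finToFun c)))

  hasMonotonicCycle-≤ : ∀ U m → HasMonotonicCycle U m → m ≤ order G
  hasMonotonicCycle-≤ U (suc k) (i , C) =
    injective⇒≤ (IsMonotonicCycle.distinct C ∘ cong (Inverse.to U))

  singleton : ∀ U → HasMonotonicCycle U 1
  singleton U = (λ _ → first (nonempty G)) , record
    { distinct    = λ { {zero} {zero} _ → refl }
    ; increasing  = λ ()
    ; consecutive = λ ()
    ; closing     = λ { (s≤s ()) }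
    }
    where
    first : ∀ {n} → NonZero n → Fin n
    first {suc n} _ = zero

  maximumCycle : ∀ U → ∃ (IsMaximum (HasMonotonicCycle U))
  maximumCycle U = maximum (hasMonotonicCycle? U) (order G) (hasMonotonicCycle-≤ U) (1 , singleton U)

  -- The quantity usually written |U|.
  longest : LinearOrdering G → ℕ
  longest U = proj₁ (maximumCycle U)

  longest-isMaximum : ∀ U → IsMaximum (HasMonotonicCycle U) (longest U)
  longest-isMaximum U = proj₂ (maximumCycle U)

  longest-cong : ∀ U U′ → Inverse.to U ≗ Inverse.to U′ → longest U ≡ longest U′
  longest-cong U U′ U≗U′ = ≤-antisym
    (proj₂ (longest-isMaximum U′) _ (hasMonotonicCycle-resp U U′ U≗U′ _ (proj₁ (longest-isMaximum U))))
    (proj₂ (longest-isMaximum U) _ (hasMonotonicCycle-resp U′ U (sym ∘ U≗U′) _ (proj₁ (longest-isMaximum U′))))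

  OrderingOfLength : ℕ → Set
  OrderingOfLength k = Σ[ U ∈ LinearOrdering G ] longest U ≡ k

  -- Decided by searching the codes a, b of pairs of mutually inverse
  -- functions Fin (order G) → Fin (order G).
  orderingOfLength? : Decidable OrderingOfLength
  orderingOfLength? k = map′
    (λ (a , b , inv , eq) → ordering a b inv , eq)
    complete
    (any? λ a → any? λ b → coded? a b)
    where
    n = order G
    e = enumeration G
    Code = Fin (n ^ n)

    fun : Code → Fin n → Fin n
    fun = finToFun

    MutuallyInverse : Code → Code → Set
    MutuallyInverse a b = (∀ x → fun a (fun b x) ≡ x) × (∀ x → fun b (fun a x) ≡ x)

    ordering : ∀ a b → MutuallyInverse a b → LinearOrdering G
    ordering a b (l , r) = e ↔-∘ mk↔ₛ′ (fun a) (fun b) l r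

    Coded : Code → Code → Set
    Coded a b = Σ[ inv ∈ MutuallyInverse a b ] longest (ordering a b inv) ≡ k

    coded? : ∀ a b → Dec (Coded a b)
    coded? a b with all? (λ x → fun a (fun b x) ≟ᶠ x) ×-dec all? (λ x → fun b (fun a x) ≟ᶠ x)
    ... | no ¬inv = no (¬inv ∘ proj₁)
    ... | yes inv = map′ (inv ,_)
      (λ (inv′ , eq) → trans (longest-cong (ordering a b inv) (ordering a b inv′) (λ _ → refl)) eq)
      (longest (ordering a b inv) ≟ℕ k)

    complete : OrderingOfLength k → Σ[ a ∈ Code ] Σ[ b ∈ Code ] Coded a b
    complete (U , eq) = a , b , inv , trans (longest-cong (ordering a b inv) U agree) eq
      where
      open Inverse e using () renaming (to to eᵗ; from to eᶠ; strictlyInverseˡ to eˡ; strictlyInverseʳ to eʳ)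
      open Inverse U using () renaming (to to u; from to v; strictlyInverseˡ to uˡ; strictlyInverseʳ to uʳ)
      f g : Fin n → Fin n
      f x = eᶠ (u x)
      g x = v (eᵗ x)
      a = funToFin f
      b = funToFin g
      a≗f : fun a ≗ f
      a≗f = finToFun-funToFin f
      b≗g : fun b ≗ g
      b≗g = finToFun-funToFin g
      inv : MutuallyInverse a b
      inv = (λ x → trans (a≗f _) (trans (cong f (b≗g x)) (trans (cong eᶠ (uˡ (eᵗ x))) (eʳ x))))
          , (λ x → trans (b≗g _) (trans (cong g (a≗f x)) (trans (cong v (eˡ (u x))) (uʳ x))))
      agree : Inverse.to (ordering a b inv) ≗ u
      agree x = trans (cong eᵗ (a≗f x)) (eˡ (u x))

  minimumLength : ∃ (IsMinimum OrderingOfLength)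
  minimumLength = minimum orderingOfLength? (longest (enumeration G) , enumeration G , refl)

  circularAltitude : ℕ
  circularAltitude = proj₁ minimumLength

  circularAltitude-isMinimum : IsMinimum OrderingOfLength circularAltitude
  circularAltitude-isMinimum = proj₂ minimumLength

{-# OPTIONS --safe #-}

-- Given a homomorphism f : G → H and an ordering U of H, order the vertices of G so that
-- the U-position of f v is weakly increasing.  Adjacent vertices of G have adjacent, hence
-- distinct, images, so f maps each monotonic cycle of G to a monotonic cycle of H of the same
-- length.  Applied to an optimal U, this shows that homomorphisms do not decrease the circular
-- altitude.

module Submission where

open import Data.Fin.Base using (Fin; zero; suc; inject₁; punchIn) renaming (_<_ to _<ᶠ_; _≤_ to _≤ᶠ_)
open import Data.Fin.Permutation using (Permutation; _⟨$⟩ʳ_; id; insert; insert-punchIn)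
open import Data.Fin.Properties using (<-cmp; <-trans; <-irrefl; ≤∧≢⇒<; ≤-totalOrder)
open import Data.List.Base using (allFin)
open import Data.List.Membership.Propositional.Properties using (∈-allFin)
open import Data.List.Relation.Unary.All using (lookup)
open import Data.Nat.Base using (zero; suc; _≤_; z≤n; s≤s)
open import Data.Nat.Properties using (<⇒≤; ≤-antisym; ≤-trans; ≤-reflexive)
open import Data.Product.Base using (∃; _,_; proj₁; proj₂)
open import Defs
open import Function.Base using (_∘_)
open import Function.Bundles using (Inverse)
open import Function.Construct.Composition using (_↔-∘_)
open import Function.Definitions using (Injective)
open import Relation.Binary.Bundles using (TotalOrder)
open import Relation.Binary.Core using (Rel; _Preserves_⟶_)
open import Relation.Binary.Definitions using (Transitive; tri<; tri≈; tri>)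
open import Relation.Binary.PropositionalEquality using (_≡_; refl; sym; trans; cong; subst₂)
open import Relation.Nullary using (contradiction)

module _ {a ℓ₁ ℓ₂} (O : TotalOrder a ℓ₁ ℓ₂) where
  open TotalOrder O using (Carrier) renaming (_≤_ to _≲_)
  open import Data.List.Extrema O using (argmin; f[argmin]≤f[xs])

  leastIndex : ∀ {n} (key : Fin (suc n) → Carrier) → ∃ λ k → ∀ i → key k ≲ key i
  leastIndex {n} key = argmin key zero (allFin (suc n)) ,
    λ i → lookup (f[argmin]≤f[xs] {f = key} zero (allFin (suc n))) (∈-allFin i)

  -- Selection sort: an index `k` of least key is sent to the front, and the remaining indices,
  -- reached through `punchIn k`, are sorted recursively.
  sortingPermutation : ∀ {n} (key : Fin n → Carrier) →
                       ∃ λ (π : Permutation n n) → (key ∘ (π ⟨$⟩ʳ_)) Preserves _≤ᶠ_ ⟶ _≲_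
  sortingPermutation {zero} key = id , λ { {()} }
  sortingPermutation {suc n} key
    with k , least ← leastIndex key
    with σ , sorted ← sortingPermutation (key ∘ punchIn k)
    = insert zero k σ , λ {i} {j} → monotone i j
    where
    monotone : ∀ i j → i ≤ᶠ j → key (insert zero k σ ⟨$⟩ʳ i) ≲ key (insert zero k σ ⟨$⟩ʳ j)
    -- `insert zero k σ` computes to `k` at `zero`, so minimality of `key k` applies as it stands.
    monotone zero    j       _         = least (insert zero k σ ⟨$⟩ʳ j)
    monotone (suc i) (suc j) (s≤s i≤j) = subst₂ (λ x y → key x ≲ key y)
      (sym (insert-punchIn zero k σ i)) (sym (insert-punchIn zero k σ j)) (sorted i≤j)

module _ {a ℓ} {A : Set a} (_⊏_ : Rel A ℓ) (⊏-trans : Transitive _⊏_) where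

  -- Induction on the sequence: transitivity joins the first step to the claim for the tail
  -- `p ∘ suc`.
  increasing-steps⇒monotone : ∀ {k} (p : Fin (suc k) → A) →
                              (∀ t → p (inject₁ t) ⊏ p (suc t)) → p Preserves _<ᶠ_ ⟶ _⊏_
  increasing-steps⇒monotone {suc k} p step {zero}  {suc zero}    _         = step zero
  increasing-steps⇒monotone {suc k} p step {zero}  {suc (suc t)} _         =
    ⊏-trans (step zero) (increasing-steps⇒monotone (p ∘ suc) (step ∘ suc) {zero} {suc t} (s≤s z≤n))
  increasing-steps⇒monotone {suc k} p step {suc s} {suc t}       (s≤s s<t) =
    increasing-steps⇒monotone (p ∘ suc) (step ∘ suc) s<t

strictlyMonotone⇒injective : ∀ {m n} {p : Fin m → Fin n} → p Preserves _<ᶠ_ ⟶ _<ᶠ_ → Injective _≡_ _≡_ p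
strictlyMonotone⇒injective mono {s} {t} eq with <-cmp s t
... | tri< s<t _ _ = contradiction (mono s<t) (<-irrefl eq)
... | tri≈ _ s≡t _ = s≡t
... | tri> _ _ t<s = contradiction (mono t<s) (<-irrefl (sym eq))

module _ {G H : Graph} (hom : Homomorphism G H) where
  open Graph
  open Homomorphism hom renaming (map to f)

  module _ (U : LinearOrdering H) where
    open Inverse U using () renaming (to to u; from to position; strictlyInverseˡ to u-position; strictlyInverseʳ to position-u)

    -- Vertices with the same image under `f` may come in any order. These ties are harmless: such
    -- vertices are never adjacent, because `H` has no loops.
    pullback : ∃ λ (W : LinearOrdering G) → (position ∘ f ∘ Inverse.to W) Preserves _≤ᶠ_ ⟶ _≤ᶠ_
    pullback
      with π , sorted ← sortingPermutation (≤-totalOrder (order H)) (position ∘ f ∘ Inverse.to (enumeration G))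
      = enumeration G ↔-∘ π , sorted

    module _ (W : LinearOrdering G) (sorted : (position ∘ f ∘ Inverse.to W) Preserves _≤ᶠ_ ⟶ _≤ᶠ_) where
      open Inverse W using () renaming (to to w)

      image-isMonotonicCycle : ∀ {k} {i : Fin (suc k) → Fin (order G)} →
                               IsMonotonicCycle G W i → IsMonotonicCycle H U (position ∘ f ∘ w ∘ i)
      image-isMonotonicCycle {k} {i} C = record
        -- Since `f` need not be injective, distinctness is not inherited from `C`; it follows from
        -- the strict increase of the positions in `U`.
        { distinct    = λ {s} {t} eq → strictlyMonotone⇒injective
            (increasing-steps⇒monotone _<ᶠ_ <-trans (position ∘ f ∘ w ∘ i) increasing′)
            (trans (sym (position-u _)) (trans (cong position eq) (position-u _)))
        ; increasing  = increasing′
        ; consecutive = λ t → adjacent-images (consecutive t)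
        ; closing     = λ 1<m → adjacent-images (closing 1<m)
        }
        where
        open IsMonotonicCycle C

        adjacent-images : ∀ {x y} → Adjacent G x y → Adjacent H (u (position (f x))) (u (position (f y)))
        adjacent-images xy =
          subst₂ (Adjacent H) (sym (u-position _)) (sym (u-position _)) (preserve _ _ xy)

        increasing′ : ∀ t → position (f (w (i (inject₁ t)))) <ᶠ position (f (w (i (suc t))))
        -- Sortedness gives only a weak inequality; equal positions would make two adjacent vertices
        -- of `H` coincide.
        increasing′ t = ≤∧≢⇒< (sorted (<⇒≤ (increasing t)))
          (λ eq → irreflexive H (cong u eq) (adjacent-images (consecutive t)))

      image-hasMonotonicCycle : ∀ m → HasMonotonicCycle G W m → HasMonotonicCycle H U m
      image-hasMonotonicCycle (suc k) (i , C) = position ∘ f ∘ w ∘ i , image-isMonotonicCycle C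

      longest-≤ : longest G W ≤ longest H U
      longest-≤ = proj₂ (longest-isMaximum H U) _
        (image-hasMonotonicCycle _ (proj₁ (longest-isMaximum G W)))

  circularAltitude-mono : circularAltitude G ≤ circularAltitude H
  circularAltitude-mono
    with (U , eq) , _ ← circularAltitude-isMinimum H
    with W , sorted ← pullback U
    -- `U` attains the minimum for `H`, whereas `W` is merely one candidate for `G` and bounds its
    -- minimum from above.
    = ≤-trans (proj₂ (circularAltitude-isMinimum G) _ (W , refl))
        (≤-trans (longest-≤ U W sorted) (≤-reflexive eq))

theorem2 : (G H : Graph) → HomomorphicallyEquivalent G H → circularAltitude G ≡ circularAltitude H
theorem2 G H (G→H , H→G) = ≤-antisym (circularAltitude-mono G→H) (circularAltitude-mono H→G)
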